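{- Let $G$ be any connected cubic graph and let $H$ be a connected $3$-chromatic cubic graph (i.e. $H \in Q_3$). If $G$ has a strong equitable $4$-coloring, then $\chi_=(G \circ^l H) = 4$ for every integer $l \geq 1$.
   Context: All graphs are finite and simple. A cubic graph is a $3$-regular graph; $Q_3$ denotes the class of connected cubic graphs with chromatic number $3$. A graph $F$ is equitably $k$-colorable if $V(F)$ can be partitioned into $k$ (possibly empty) independent sets $V_1,\dots,V_k$ with $\bigl||V_i|-|V_j|\bigr|\le 1$ for all $i,j$. The equitable chromatic number $\chi_=(F)$ is the smallest integer $k$ such that $F$ is equitably $k$-colorable. A strong equitable $k$-coloring of $F$ is a partition of $V(F)$ into $k$ independent sets all of the same cardinality. The corona $G\circ H$ of graphs $G$ and $H$ is formed from one copy of $G$ and $|V(G)|$ disjoint copies of $H$ by joining the $i$-th vertex of $G$ to every vertex of the $i$-th copy of $H$. The $l$-corona product is defined by $G\circ^1 H = G\circ H$ and $G\circ^l H = (G\circ^{l-1}H)\circ H$ for $l\ge 2$. -}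

module Defs where

open import Level using (Level)
open import Data.Fin.Base using (Fin)
import Data.Fin.Properties as Fin
open import Data.List.Base using (List; _++_; map; filter; length; cartesianProduct)
open import Data.List.Membership.Propositional using (_∈_)
open import Data.List.Membership.Propositional.Properties
  using (∈-map⁺; ∈-map⁻; ∈-++⁺ˡ; ∈-++⁺ʳ; ∈-cartesianProduct⁺)
open import Data.List.Relation.Unary.Unique.Propositional using (Unique)
open import Data.List.Relation.Unary.Unique.Propositional.Properties
  using (map⁺; ++⁺; cartesianProduct⁺)
open import Data.Nat.Base using (ℕ; zero; suc; _≤_; ∣_-_∣)
open import Data.Product.Base using (Σ-syntax; _×_; _,_)
open import Data.Product.Properties using () renaming (≡-dec to ×-≡-dec)
open import Data.Sum.Base using (_⊎_; inj₁; inj₂)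
open import Data.Sum.Properties using (inj₁-injective; inj₂-injective) renaming (≡-dec to ⊎-≡-dec)
open import Relation.Binary.Construct.Closure.ReflexiveTransitive using (Star)
open import Relation.Binary.Definitions using (DecidableEquality; Decidable; Symmetric; Irreflexive)
open import Relation.Binary.PropositionalEquality.Core using (_≡_; refl; sym)
open import Relation.Nullary.Decidable.Core using (_×-dec_)
open import Relation.Nullary.Negation.Core using (¬_)

private
  variable
    p : Level

-- The duplicate-free, complete list `vertices` is what makes V finite, so the
-- length of a filtered `vertices` is the cardinality of the filtered subset.
record Graph : Set₁ where
  field
    V          : Set
    _≟_        : DecidableEquality V
    vertices   : List V
    unique     : Unique vertices
    complete   : ∀ v → v ∈ vertices
    Adj        : V → V → Set
    adj?       : Decidable Adj
    adj-sym    : Symmetric Adj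
    adj-irrefl : Irreflexive _≡_ Adj

  degree : V → ℕ
  degree v = length (filter (adj? v) vertices)

  Independent : (V → Set p) → Set p
  Independent S = ∀ {u v} → S u → S v → ¬ Adj u v

open Graph using (V)

-- The empty graph is not connected.
Connected : Graph → Set
Connected G = V G × (∀ u v → Star (Graph.Adj G) u v)

Cubic : Graph → Set
Cubic G = ∀ v → Graph.degree G v ≡ 3

-- A partition into k indexed, possibly empty, parts V₁, …, Vₖ is the function
-- sending each vertex to the index of its part.
Partition : Graph → ℕ → Set
Partition G k = V G → Fin k

module _ (G : Graph) {k : ℕ} (c : Partition G k) where

  Part : Fin k → V G → Set
  Part i v = c v ≡ i

  IndependentParts : Set
  IndependentParts = ∀ i → Graph.Independent G (Part i)

  partSize : Fin k → ℕ
  partSize i = length (filter (λ v → c v Fin.≟ i) (Graph.vertices G))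

Colorable : Graph → ℕ → Set
Colorable G k = Σ[ c ∈ Partition G k ] IndependentParts G c

EquitablyColorable : Graph → ℕ → Set
EquitablyColorable G k =
  Σ[ c ∈ Partition G k ] IndependentParts G c ×
    (∀ i j → ∣ partSize G c i - partSize G c j ∣ ≤ 1)

StrongEquitablyColorable : Graph → ℕ → Set
StrongEquitablyColorable G k =
  Σ[ c ∈ Partition G k ] IndependentParts G c ×
    (∀ i j → partSize G c i ≡ partSize G c j)

Least : (ℕ → Set) → ℕ → Set
Least P k = P k × (∀ j → P j → k ≤ j)

-- `ChromaticNumber G k` says χ(G) = k, and likewise for χ₌.
ChromaticNumber : Graph → ℕ → Set
ChromaticNumber G = Least (Colorable G)

EquitableChromaticNumber : Graph → ℕ → Set
EquitableChromaticNumber G = Least (EquitablyColorable G)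

Q₃ : Graph → Set
Q₃ G = Connected G × Cubic G × ChromaticNumber G 3

module Corona (G H : Graph) where
  private
    module G = Graph G
    module H = Graph H

  -- inj₂ (u , x) is the vertex x of the copy of H attached to u.
  Vertex : Set
  Vertex = G.V ⊎ (G.V × H.V)

  Adj : Vertex → Vertex → Set
  Adj (inj₁ u)       (inj₁ v)       = G.Adj u v
  Adj (inj₁ u)       (inj₂ (v , _)) = u ≡ v
  Adj (inj₂ (u , _)) (inj₁ v)       = u ≡ v
  Adj (inj₂ (u , x)) (inj₂ (v , y)) = u ≡ v × H.Adj x y

  adj? : Decidable Adj
  adj? (inj₁ u)       (inj₁ v)       = G.adj? u v
  adj? (inj₁ u)       (inj₂ (v , _)) = u G.≟ v
  adj? (inj₂ (u , _)) (inj₁ v)       = u G.≟ v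
  adj? (inj₂ (u , x)) (inj₂ (v , y)) = (u G.≟ v) ×-dec H.adj? x y

  adj-sym : Symmetric Adj
  adj-sym {inj₁ _} {inj₁ _} a       = G.adj-sym a
  adj-sym {inj₁ _} {inj₂ _} e       = sym e
  adj-sym {inj₂ _} {inj₁ _} e       = sym e
  adj-sym {inj₂ _} {inj₂ _} (e , a) = sym e , H.adj-sym a

  adj-irrefl : Irreflexive _≡_ Adj
  adj-irrefl {inj₁ _} refl a       = G.adj-irrefl refl a
  adj-irrefl {inj₂ _} refl (_ , a) = H.adj-irrefl refl a

  vertices : List Vertex
  vertices = map inj₁ G.vertices ++ map inj₂ (cartesianProduct G.vertices H.vertices)

  unique : Unique vertices
  unique = ++⁺ (map⁺ inj₁-injective G.unique)
               (map⁺ inj₂-injective (cartesianProduct⁺ G.unique H.unique))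
               disjoint
    where
    disjoint : ∀ {w} → ¬ (w ∈ map inj₁ G.vertices ×
                          w ∈ map inj₂ (cartesianProduct G.vertices H.vertices))
    disjoint (p , q) with ∈-map⁻ inj₁ p | ∈-map⁻ inj₂ q
    ... | _ , _ , refl | _ , _ , ()

  complete : ∀ w → w ∈ vertices
  complete (inj₁ u)       = ∈-++⁺ˡ (∈-map⁺ inj₁ (G.complete u))
  complete (inj₂ (u , x)) = ∈-++⁺ʳ (map inj₁ G.vertices)
    (∈-map⁺ inj₂ (∈-cartesianProduct⁺ (G.complete u) (H.complete x)))

  corona : Graph
  corona = record
    { V          = Vertex
    ; _≟_        = ⊎-≡-dec G._≟_ (×-≡-dec G._≟_ H._≟_)
    ; vertices   = vertices
    ; unique     = unique
    ; complete   = complete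
    ; Adj        = Adj
    ; adj?       = adj?
    ; adj-sym    = λ {u} {v} → adj-sym {u} {v}
    ; adj-irrefl = λ {u} {v} → adj-irrefl {u} {v}
    }

open Corona public using (corona)

-- G ∘^ l H; the case l = 0 is only the base of the recursion, and l = 1 gives
-- `corona G H` by definition.
lCorona : Graph → ℕ → Graph → Graph
lCorona G zero    H = G
lCorona G (suc l) H = corona (lCorona G l H) H

{-# OPTIONS --safe #-}
-- Colour the copy of H at a vertex u of colour i by sending the classes 0, 1, 2
-- of a fixed 3-colouring of H to i + 1, i + 2, i + 3 modulo 4. For a vertex x of H
-- in class k, the copies of x coloured j are those hanging on vertices coloured
-- j − k − 1, so if the four classes of the base graph are equal then so are those
-- of the corona, whatever the class sizes of H. Conversely, a copy of H avoids the
-- colour of the vertex it hangs on, so k + 1 colours for a corona give k for H.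
module Submission where

open import Defs
open import Data.Bool.Base using (true; false)
open import Data.Fin.Base using (Fin; zero; toℕ; punchOut)
open import Data.Fin.Properties using (all?; punchOut-injective)
  renaming (_≟_ to _≟F_)
open import Data.List.Base using (List; []; _∷_; _++_; map; filter; length; cartesianProduct)
open import Data.List.Properties using (filter-++; length-++; filter-≐)
open import Data.Nat.Base using (ℕ; zero; suc; _+_; _*_; _∸_; _≤_; z≤n; s≤s)
open import Data.Nat.DivMod using (_mod_)
open import Data.Nat.Properties using (≤-reflexive; ≤-trans; m≡n⇒∣m-n∣≡0)
open import Data.Nat.Solver using (module +-*-Solver)
open import Data.Product.Base using (_×_; _,_)
open import Data.Sum.Base using (inj₁; inj₂)
open import Function.Base using (_∘_)
open import Level using (Level)
open import Relation.Binary.PropositionalEquality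
  using (_≡_; _≢_; refl; sym; trans; cong; cong₂; module ≡-Reasoning)
open import Relation.Nullary.Decidable using (does; from-yes; _→-dec_; ¬?)
open import Relation.Unary using (Pred; Decidable)

private
  variable
    a b p : Level
    A : Set a
    B : Set b

count : {P : Pred A p} → Decidable P → List A → ℕ
count P? xs = length (filter P? xs)

count-++ : {P : Pred A p} (P? : Decidable P) (xs ys : List A) →
  count P? (xs ++ ys) ≡ count P? xs + count P? ys
count-++ P? xs ys =
  trans (cong length (filter-++ P? xs ys)) (length-++ (filter P? xs))

count-map : {P : Pred B p} (P? : Decidable P) (f : A → B) (xs : List A) →
  count P? (map f xs) ≡ count (P? ∘ f) xs
count-map P? f [] = refl
count-map P? f (x ∷ xs) with does (P? (f x))
... | true  = cong suc (count-map P? f xs)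
... | false = count-map P? f xs

-- `cartesianProduct` lists pairs row by row, with the first coordinate fixed, while the argument
-- fixes a vertex of `H`, the second coordinate. Peeling off a column therefore takes an induction
-- over the rows.
count-cartesianProduct-∷ : {P : Pred (A × B) p} (P? : Decidable P)
  (xs : List A) (y : B) (ys : List B) →
  count P? (cartesianProduct xs (y ∷ ys)) ≡
  count (λ x → P? (x , y)) xs + count P? (cartesianProduct xs ys)
count-cartesianProduct-∷ P? [] y ys = refl
count-cartesianProduct-∷ {P = P} P? (x ∷ xs) y ys = begin
  count P? ((x , y) ∷ row ++ cartesianProduct xs (y ∷ ys))
    ≡⟨ count-++ P? ((x , y) ∷ []) (row ++ cartesianProduct xs (y ∷ ys)) ⟩
  h + count P? (row ++ cartesianProduct xs (y ∷ ys))
    ≡⟨ cong (h +_) (count-++ P? row (cartesianProduct xs (y ∷ ys))) ⟩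
  h + (r + count P? (cartesianProduct xs (y ∷ ys)))
    ≡⟨ cong (λ n → h + (r + n)) (count-cartesianProduct-∷ P? xs y ys) ⟩
  h + (r + (c + t))
    -- The corner `h` moves from its row `r` to its column `c`; `t` counts the pairs outside both.
    ≡⟨ solve 4 (λ h r c t → h :+ (r :+ (c :+ t)) := (h :+ c) :+ (r :+ t)) refl h r c t ⟩
  (h + c) + (r + t)
    ≡⟨ cong₂ _+_
         (cong (_+ c) (count-map P? (_, y) (x ∷ [])))
         (sym (count-++ P? row (cartesianProduct xs ys))) ⟩
  (count Py? (x ∷ []) + c) + count P? (row ++ cartesianProduct xs ys)
    ≡⟨ cong (_+ count P? (row ++ cartesianProduct xs ys)) (sym (count-++ Py? (x ∷ []) xs)) ⟩
  count Py? (x ∷ xs) + count P? (row ++ cartesianProduct xs ys)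
    ∎
  where
  open ≡-Reasoning
  open +-*-Solver
  Py? : Decidable (λ x → P (x , y))
  Py? x = P? (x , y)
  row = map (x ,_) ys
  h = count P? ((x , y) ∷ [])
  r = count P? row
  c = count Py? xs
  t = count P? (cartesianProduct xs ys)

count-cartesianProduct : {P : Pred (A × B) p} (P? : Decidable P) (xs : List A) (m : ℕ) →
  (∀ y → count (λ x → P? (x , y)) xs ≡ m) →
  (ys : List B) → count P? (cartesianProduct xs ys) ≡ length ys * m
count-cartesianProduct P? [] m eq [] = refl
-- The product with `[]` only reduces by recursion on its first argument, hence the inner induction.
count-cartesianProduct P? (x ∷ xs) m eq [] = count-cartesianProduct-[] xs
  where
  count-cartesianProduct-[] : ∀ xs → count P? (cartesianProduct xs []) ≡ 0
  count-cartesianProduct-[] []       = refl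
  count-cartesianProduct-[] (_ ∷ xs) = count-cartesianProduct-[] xs
count-cartesianProduct P? xs m eq (y ∷ ys) =
  trans (count-cartesianProduct-∷ P? xs y ys)
        (cong₂ _+_ (eq y) (count-cartesianProduct P? xs m eq ys))

shift : Fin 4 → Fin 3 → Fin 4
shift i k = (toℕ i + suc (toℕ k)) mod 4

-- The offsets `suc k` and `3 ∸ k` add up to 4. The truncated subtraction is exact because `k` is at
-- most 2.
unshift : Fin 4 → Fin 3 → Fin 4
unshift j k = (toℕ j + (3 ∸ toℕ k)) mod 4

-- The offset lies between 1 and 3, so it is nonzero modulo 4. This fact and the next three are
-- decided by evaluating all cases, at most 36 of them.
shift-≢ : ∀ i k → shift i k ≢ i
shift-≢ = from-yes (all? λ i → all? λ k → ¬? (shift i k ≟F i))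

shift-injective : ∀ i k k′ → shift i k ≡ shift i k′ → k ≡ k′
shift-injective = from-yes (all? λ i → all? λ k → all? λ k′ →
  (shift i k ≟F shift i k′) →-dec (k ≟F k′))

shift-unshift : ∀ j k → shift (unshift j k) k ≡ j
shift-unshift = from-yes (all? λ j → all? λ k → shift (unshift j k) k ≟F j)

unshift-shift : ∀ i k → unshift (shift i k) k ≡ i
unshift-shift = from-yes (all? λ i → all? λ k → unshift (shift i k) k ≟F i)

module _ (G H : Graph) (c : Partition G 4) (d : Partition H 3) where
  private
    module G = Graph G
    module H = Graph H

  coronaColoring : Partition (corona G H) 4
  coronaColoring (inj₁ u)       = c u
  coronaColoring (inj₂ (u , x)) = shift (c u) (d x)

  coronaColoring-independent : IndependentParts G c → IndependentParts H d →
    IndependentParts (corona G H) coronaColoring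
  coronaColoring-independent ic id i {inj₁ u} {inj₁ v} p q e = ic i p q e
  coronaColoring-independent ic id i {inj₁ u} {inj₂ (.u , y)} p q refl =
    shift-≢ (c u) (d y) (trans q (sym p))
  coronaColoring-independent ic id i {inj₂ (u , x)} {inj₁ .u} p q refl =
    shift-≢ (c u) (d x) (trans p (sym q))
  coronaColoring-independent ic id i {inj₂ (u , x)} {inj₂ (.u , y)} p q (refl , e) =
    id (d x) refl (sym (shift-injective (c u) (d x) (d y) (trans p (sym q)))) e

  -- For fixed `k`, `shift` permutes the four colours with inverse `unshift`, so both sides filter
  -- by equivalent predicates.
  count-shift : ∀ j k →
    count (λ u → shift (c u) k ≟F j) G.vertices ≡ partSize G c (unshift j k)
  count-shift j k = cong length (filter-≐ _ _
    ( (λ {u} e → trans (sym (unshift-shift (c u) k)) (cong (λ i → unshift i k) e))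
    , (λ {u} e → trans (cong (λ i → shift i k) e) (shift-unshift j k)))
    G.vertices)

  partSize-coronaColoring : (∀ i j → partSize G c i ≡ partSize G c j) → ∀ j →
    partSize (corona G H) coronaColoring j ≡
    partSize G c zero + length H.vertices * partSize G c zero
  partSize-coronaColoring eq j =
    trans (count-++ P? (map inj₁ G.vertices) _)
      (cong₂ _+_
        (trans (count-map P? inj₁ G.vertices) (eq j zero))
        (trans (count-map P? inj₂ (cartesianProduct G.vertices H.vertices))
          -- Each column counts some class of `c`; as all classes have equal size, `zero` serves as
          -- the reference class whatever `d x` is.
          (count-cartesianProduct (P? ∘ inj₂) G.vertices (partSize G c zero)
            (λ x → trans (count-shift j (d x)) (eq (unshift j (d x)) zero))
            H.vertices)))
    where
    P? : Decidable (λ v → coronaColoring v ≡ j)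
    P? v = coronaColoring v ≟F j

corona-strongEquitable : (G H : Graph) → Colorable H 3 →
  StrongEquitablyColorable G 4 → StrongEquitablyColorable (corona G H) 4
corona-strongEquitable G H (d , id) (c , ic , eq) =
  coronaColoring G H c d ,
  coronaColoring-independent G H c d ic id ,
  λ i j → trans (partSize-coronaColoring G H c d eq i)
                (sym (partSize-coronaColoring G H c d eq j))

-- Exact equality of the classes is the invariant: each corona layer consumes it and restores it.
lCorona-strongEquitable : (G H : Graph) → Colorable H 3 →
  StrongEquitablyColorable G 4 → ∀ l → StrongEquitablyColorable (lCorona G l H) 4
lCorona-strongEquitable G H col s zero    = s
lCorona-strongEquitable G H col s (suc l) =
  corona-strongEquitable (lCorona G l H) H col (lCorona-strongEquitable G H col s l)

strongEquitable⇒equitable : (G : Graph) {k : ℕ} →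
  StrongEquitablyColorable G k → EquitablyColorable G k
strongEquitable⇒equitable G (c , ic , eq) =
  c , ic , λ i j → ≤-trans (≤-reflexive (m≡n⇒∣m-n∣≡0 (eq i j))) z≤n

corona-colorable⁻ : (G H : Graph) → Graph.V G → ∀ {k} →
  Colorable (corona G H) (suc k) → Colorable H k
corona-colorable⁻ G H u (c , ic) =
  -- `punchOut` closes the gap left by the colour of `u`; its injectivity keeps adjacent vertices of
  -- the copy apart.
  (λ x → punchOut (avoids x)) ,
  λ i p q e → ic _ refl
    (sym (punchOut-injective (avoids _) (avoids _) (trans p (sym q)))) (refl , e)
  where
  avoids : ∀ x → c (inj₁ u) ≢ c (inj₂ (u , x))
  avoids x eq = ic _ {inj₁ u} {inj₂ (u , x)} eq refl refl

corona-colors : (G H : Graph) → Graph.V G → ∀ {n} → (∀ k → Colorable H k → n ≤ k) →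
  ∀ k → Colorable (corona G H) k → suc n ≤ k
corona-colors G H u min zero    (c , _) with () ← c (inj₁ u)
corona-colors G H u min (suc k) col = s≤s (min k (corona-colorable⁻ G H u col))

lCorona-vertex : (G H : Graph) → Graph.V G → ∀ l → Graph.V (lCorona G l H)
lCorona-vertex G H u zero    = u
lCorona-vertex G H u (suc l) = inj₁ (lCorona-vertex G H u l)

theorem3p4 : (G H : Graph) → Connected G → Cubic G → Q₃ H →
    StrongEquitablyColorable G 4 →
    (l : ℕ) → 1 ≤ l → EquitableChromaticNumber (lCorona G l H) 4
theorem3p4 G H (u , _) _ (_ , _ , col , min) s (suc l) _ =
  strongEquitable⇒equitable (lCorona G (suc l) H)
    (lCorona-strongEquitable G H col s (suc l)) ,
  -- The outermost layer suffices: `min` gives at least 3 colours for `H`, and the vertex carrying a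
  -- copy forces a fourth.
  λ k (c , ic , _) →
    corona-colors (lCorona G l H) H (lCorona-vertex G H u l) min k (c , ic)
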